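{- Let $k\ge 3$ be an integer and let $G$ be a connected graph with $\Delta(G)\geq k$. Then $L_k(G)\geq \mathrm{diam}(G)+k-2$. Moreover, the lower bound is tight: for every $k\ge 3$ there is a connected graph $G$ with $\Delta(G)\ge k$ and $L_k(G)=\mathrm{diam}(G)+k-2$.
   Context: All graphs are finite, undirected, simple and nontrivial (at least two vertices). $\Delta(G)$ is the maximum degree, $\mathrm{diam}(G)$ the diameter, and $N[v]=\{v\}\cup N(v)$ the closed neighbourhood of $v$. For an integer $k\ge 1$, a set $B\subseteq V(G)$ is a $k$-limited packing if $|N[v]\cap B|\le k$ for every vertex $v$ of $G$; $L_k(G)$ is the maximum cardinality of a $k$-limited packing in $G$. -}

module Defs where

open import Data.Fin.Base using (Fin)
open import Data.Fin.Properties using (any?; all?) renaming (_≟_ to _≟ᶠ_)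
open import Data.Fin.Subset using (Subset; ⊥; ⁅_⁆; _∩_; _∪_; ∣_∣)
open import Data.Fin.Subset.Properties using (anySubset?; ∣⊥∣≡0; ∣p∣≤n; ∩-zeroʳ)
open import Data.List.Base using (tabulate)
open import Data.List.Extrema.Nat using (max)
open import Data.Nat.Base using (ℕ; zero; suc; _≤_; z≤n; s≤s; s≤s⁻¹)
open import Data.Nat.Properties using (_≟_; _≤?_; ≤∧≢⇒<; n≤0⇒n≡0; ≤-reflexive; ≤-trans)
open import Data.Product.Base using (∃; ∃-syntax; _×_; _,_; proj₁)
import Data.Vec.Base as Vec
open import Level using (0ℓ)
open import Relation.Binary.Core using (Rel)
import Relation.Binary.Definitions as B
open import Relation.Binary.PropositionalEquality using (_≡_; refl; trans; cong)
open import Relation.Nullary.Decidable using (yes; no; does; map′; _×-dec_)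
open import Relation.Nullary.Negation using (contradiction)
open import Relation.Unary using (Pred; Decidable)

IsLeast : Pred ℕ 0ℓ → Pred ℕ 0ℓ
IsLeast P m = P m × (∀ i → P i → m ≤ i)

IsGreatest : Pred ℕ 0ℓ → Pred ℕ 0ℓ
IsGreatest P m = P m × (∀ i → P i → i ≤ m)

least : {P : Pred ℕ 0ℓ} → Decidable P → ∃ P → ∃ (IsLeast P)
least P? (m , pm) = search P? m pm
  where
  search : {P : Pred ℕ 0ℓ} → Decidable P → ∀ m → P m → ∃ (IsLeast P)
  search P? m pm with P? 0
  ... | yes p0 = 0 , p0 , λ _ _ → z≤n
  search P? zero pm | no ¬p0 = contradiction pm ¬p0
  search P? (suc m) pm | no ¬p0 with search (λ i → P? (suc i)) m pm
  ... | j , pj , j≤ = suc j , pj , λ where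
    zero    p0 → contradiction p0 ¬p0
    (suc i) pi → s≤s (j≤ i pi)

greatest : {P : Pred ℕ 0ℓ} → Decidable P → ∃ P →
           ∀ b → (∀ i → P i → i ≤ b) → ∃ (IsGreatest P)
greatest P? w b ≤b with P? b
... | yes pb = b , pb , ≤b
greatest P? (i , pi) zero ≤b | no ¬pb with refl ← n≤0⇒n≡0 (≤b i pi) =
  contradiction pi ¬pb
greatest P? w (suc b) ≤b | no ¬pb = greatest P? w b λ i pi →
  s≤s⁻¹ (≤∧≢⇒< (≤b i pi) λ where refl → ¬pb pi)

-- Finite simple graphs with at least two vertices; the vertex set is Fin order.
record Graph : Set₁ where
  field
    order      : ℕ
    nontrivial : 2 ≤ order

  Vertex : Set
  Vertex = Fin order

  field
    Adj        : Rel Vertex 0ℓ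
    adj?       : B.Decidable Adj
    adj-sym    : B.Symmetric Adj
    adj-irrefl : B.Irreflexive _≡_ Adj

module _ (G : Graph) where
  open Graph G

  N : Vertex → Subset order
  N v = Vec.tabulate λ u → does (adj? v u)

  N[_] : Vertex → Subset order
  N[ v ] = ⁅ v ⁆ ∪ N v

  degree : Vertex → ℕ
  degree v = ∣ N v ∣

  -- The base value 0 of max is harmless: the list is nonempty.
  Δ : ℕ
  Δ = max 0 (tabulate degree)

  data Walk : Vertex → Vertex → ℕ → Set where
    []  : ∀ {u} → Walk u u 0
    _∷_ : ∀ {u v w m} → Adj u v → Walk v w m → Walk u w (suc m)

  Connected : Set
  Connected = ∀ u v → ∃[ m ] Walk u v m

  walk? : ∀ u v → Decidable (Walk u v)
  walk? u v zero = map′ (λ where refl → []) (λ where [] → refl) (u ≟ᶠ v)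
  walk? u v (suc m) =
    map′ (λ (_ , e , p) → e ∷ p) (λ where (e ∷ p) → _ , e , p)
         (any? λ x → adj? u x ×-dec walk? x v m)

  -- Distances are finite only in a connected graph, so the distance and the
  -- diameter take a proof of connectedness; their values do not depend on it.
  dist : Connected → Vertex → Vertex → ℕ
  dist conn u v = proj₁ (least (walk? u v) (conn u v))

  diam : Connected → ℕ
  diam conn = max 0 (tabulate λ u → max 0 (tabulate λ v → dist conn u v))

  IsLimitedPacking : ℕ → Pred (Subset order) 0ℓ
  IsLimitedPacking k B = ∀ v → ∣ N[ v ] ∩ B ∣ ≤ k

  PackingOfSize : ℕ → Pred ℕ 0ℓ
  PackingOfSize k m = ∃[ B ] IsLimitedPacking k B × ∣ B ∣ ≡ m

  packingOfSize? : ∀ k → Decidable (PackingOfSize k)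
  packingOfSize? k m =
    anySubset? λ B → all? (λ v → ∣ N[ v ] ∩ B ∣ ≤? k) ×-dec (∣ B ∣ ≟ m)

  ∅-packing : ∀ k → PackingOfSize k 0
  ∅-packing k = ⊥ , (λ v → ≤-trans (≤-reflexive (size v)) z≤n) , ∣⊥∣≡0 order
    where
    size : ∀ v → ∣ N[ v ] ∩ ⊥ ∣ ≡ 0
    size v = trans (cong ∣_∣ (∩-zeroʳ N[ v ])) (∣⊥∣≡0 order)

  packingSize≤order : ∀ k m → PackingOfSize k m → m ≤ order
  packingSize≤order k m (B , _ , refl) = ∣p∣≤n B

  greatestPacking : ∀ k → ∃ (IsGreatest (PackingOfSize k))
  greatestPacking k =
    greatest (packingOfSize? k) (0 , ∅-packing k) order (packingSize≤order k)

L : ℕ → Graph → ℕ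
L k G = proj₁ (greatestPacking G k)

{-# OPTIONS --safe #-}
-- Choose s and t at distance diam G and one vertex at each distance 0, …, diam G
-- from t. The closed neighbourhood of v only contains vertices whose distances
-- to t differ by at most one from that of v, so these diam G + 1 vertices form a
-- 3-limited packing P. Adding any vertex to an l-limited packing gives an
-- (l+1)-limited one, so adding k − 3 arbitrary vertices to P suffices. They exist
-- because a vertex of degree at least k has at least k + 1 − 3 elements of its
-- closed neighbourhood outside P. The star with k leaves attains the bound.
module Submission where

open import Defs
open import Data.Fin.Base using (Fin; zero; suc; fromℕ<)
open import Data.Fin.Subset
  using (Subset; inside; outside; _∈_; _∉_; _⊆_; ⊤; ⊥; ⁅_⁆; _∩_; _∪_; ∣_∣)
open import Data.Fin.Subset.Properties
open import Data.List.Base using (tabulate)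
open import Data.List.Extrema.Nat using (max; argmax-sel; xs≤max)
open import Data.List.Membership.Propositional.Properties using (∈-tabulate⁺; ∈-tabulate⁻)
import Data.List.Relation.Unary.All as All
open import Data.Nat.Base
  using (ℕ; zero; suc; pred; _+_; _∸_; _⊓_; _≤_; _<_; _≥_; z≤n; s≤s; s≤s⁻¹)
open import Data.Nat.Properties
open import Data.Product.Base using (_×_; _,_; proj₁; proj₂; Σ-syntax; ∃-syntax)
open import Data.Sum.Base using (_⊎_; inj₁; inj₂; map₂)
open import Data.Vec.Base using ([]; _∷_)
open import Data.Vec.Properties using ([]=⇒lookup; lookup⇒[]=; lookup∘tabulate)
open import Function.Base using (_∘_; id)
open import Level using (0ℓ)
open import Relation.Binary.Core using (Rel)
import Relation.Binary.Definitions as B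
open import Relation.Binary.PropositionalEquality using (_≡_; refl; sym; trans; cong; subst)
open import Relation.Nullary.Decidable using (yes; no; does; dec-true)
open import Relation.Nullary.Negation using (¬_; contradiction)

private
  variable
    n : ℕ

-- Maxima of finite families and cardinalities of finite sets

max-tabulate-attained : (f : Fin n → ℕ) → Fin n → ∃[ i ] max 0 (tabulate f) ≤ f i
max-tabulate-attained f i with argmax-sel id 0 (tabulate f)
-- If the maximum is the base value 0, every index attains it, so the given one serves.
... | inj₁ max≡0 = i , ≤-trans (≤-reflexive max≡0) z≤n
... | inj₂ max∈ with j , max≡fj ← ∈-tabulate⁻ max∈ = j , ≤-reflexive max≡fj

≤max-tabulate : (f : Fin n → ℕ) → ∀ i → f i ≤ max 0 (tabulate f)
≤max-tabulate f i = All.lookup (xs≤max 0 (tabulate f)) (∈-tabulate⁺ i)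

∣p∪q∣+∣p∩q∣≡∣p∣+∣q∣ : (p q : Subset n) → ∣ p ∪ q ∣ + ∣ p ∩ q ∣ ≡ ∣ p ∣ + ∣ q ∣
∣p∪q∣+∣p∩q∣≡∣p∣+∣q∣ [] [] = refl
∣p∪q∣+∣p∩q∣≡∣p∣+∣q∣ (outside ∷ p) (outside ∷ q) = ∣p∪q∣+∣p∩q∣≡∣p∣+∣q∣ p q
∣p∪q∣+∣p∩q∣≡∣p∣+∣q∣ (inside ∷ p) (outside ∷ q) = cong suc (∣p∪q∣+∣p∩q∣≡∣p∣+∣q∣ p q)
∣p∪q∣+∣p∩q∣≡∣p∣+∣q∣ (outside ∷ p) (inside ∷ q) =
  trans (cong suc (∣p∪q∣+∣p∩q∣≡∣p∣+∣q∣ p q)) (sym (+-suc ∣ p ∣ ∣ q ∣))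
∣p∪q∣+∣p∩q∣≡∣p∣+∣q∣ (inside ∷ p) (inside ∷ q) = cong suc
  (trans (+-suc _ _) (trans (cong suc (∣p∪q∣+∣p∩q∣≡∣p∣+∣q∣ p q)) (sym (+-suc ∣ p ∣ ∣ q ∣))))

∣p∪q∣≤∣p∣+∣q∣ : (p q : Subset n) → ∣ p ∪ q ∣ ≤ ∣ p ∣ + ∣ q ∣
∣p∪q∣≤∣p∣+∣q∣ p q =
  ≤-trans (m≤m+n ∣ p ∪ q ∣ ∣ p ∩ q ∣) (≤-reflexive (∣p∪q∣+∣p∩q∣≡∣p∣+∣q∣ p q))

∣p∪⁅x⁆∣≤1+∣p∣ : (p : Subset n) (x : Fin n) → ∣ p ∪ ⁅ x ⁆ ∣ ≤ suc ∣ p ∣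
∣p∪⁅x⁆∣≤1+∣p∣ p x = begin
  ∣ p ∪ ⁅ x ⁆ ∣       ≤⟨ ∣p∪q∣≤∣p∣+∣q∣ p ⁅ x ⁆ ⟩
  ∣ p ∣ + ∣ ⁅ x ⁆ ∣   ≡⟨ cong (∣ p ∣ +_) (∣⁅x⁆∣≡1 x) ⟩
  ∣ p ∣ + 1           ≡⟨ +-comm ∣ p ∣ 1 ⟩
  suc ∣ p ∣           ∎
  where open ≤-Reasoning

x∉p⇒∣p∣<∣p∪⁅x⁆∣ : {p : Subset n} {x : Fin n} → x ∉ p → ∣ p ∣ < ∣ p ∪ ⁅ x ⁆ ∣
x∉p⇒∣p∣<∣p∪⁅x⁆∣ {p = p} {x} x∉p = p⊂q⇒∣p∣<∣q∣
  (p⊆p∪q ⁅ x ⁆ , x , x∈p∪q⁺ (inj₂ (x∈⁅x⁆ x)) , x∉p)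

∣p∣<n⇒∃∉ : (p : Subset n) → ∣ p ∣ < n → ∃[ x ] x ∉ p
∣p∣<n⇒∃∉ (outside ∷ p) _ = zero , λ ()
∣p∣<n⇒∃∉ (inside ∷ p) (s≤s ∣p∣<n) with x , x∉p ← ∣p∣<n⇒∃∉ p ∣p∣<n =
  suc x , x∉p ∘ drop-there

-- Adjoining one value at a time lets the cardinality be computed by induction on the length of the
-- sequence.
image : (ℕ → Fin n) → ℕ → Subset n
image f zero    = ⊥
image f (suc m) = image f m ∪ ⁅ f m ⁆

∈-image⁻ : (f : ℕ → Fin n) → ∀ m {x} → x ∈ image f m → ∃[ i ] i < m × x ≡ f i
∈-image⁻ f zero    x∈ = contradiction x∈ ∉⊥
∈-image⁻ f (suc m) x∈ with x∈p∪q⁻ (image f m) ⁅ f m ⁆ x∈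
... | inj₂ x∈⁅fm⁆ = m , ≤-refl , x∈⁅y⁆⇒x≡y (f m) x∈⁅fm⁆
... | inj₁ x∈image with i , i<m , x≡fi ← ∈-image⁻ f m x∈image = i , m<n⇒m<1+n i<m , x≡fi

-- Neighbourhoods and enlarging packings

module _ (G : Graph) where
  open Graph G

  ∈N⁻ : ∀ {v u} → u ∈ N G v → Adj v u
  ∈N⁻ {v} {u} u∈N
    with adj? v u | trans (sym (lookup∘tabulate (does ∘ adj? v) u)) ([]=⇒lookup u∈N)
  ... | yes vu | _ = vu

  ∈N⁺ : ∀ {v u} → Adj v u → u ∈ N G v
  ∈N⁺ {v} {u} vu = lookup⇒[]= u (N G v)
    (trans (lookup∘tabulate (does ∘ adj? v) u) (dec-true (adj? v u) vu))

  ∈N[]⁻ : ∀ {v u} → u ∈ N[_] G v → u ≡ v ⊎ Adj v u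
  ∈N[]⁻ {v} u∈ with x∈p∪q⁻ ⁅ v ⁆ (N G v) u∈
  ... | inj₁ u∈⁅v⁆ = inj₁ (x∈⁅y⁆⇒x≡y v u∈⁅v⁆)
  ... | inj₂ u∈N   = inj₂ (∈N⁻ u∈N)

  ∈N[]⁺ : ∀ {v u} → u ≡ v ⊎ Adj v u → u ∈ N[_] G v
  ∈N[]⁺ {v} {u} (inj₁ refl) = p⊆p∪q (N G v) (x∈⁅x⁆ u)
  ∈N[]⁺ {v} {u} (inj₂ vu)   = q⊆p∪q ⁅ v ⁆ (N G v) (∈N⁺ vu)

  degree<∣N[]∣ : ∀ v → degree G v < ∣ N[_] G v ∣
  degree<∣N[]∣ v = subst (λ p → degree G v < ∣ p ∣) (∪-comm (N G v) ⁅ v ⁆)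
    (x∉p⇒∣p∣<∣p∪⁅x⁆∣ (adj-irrefl refl ∘ ∈N⁻))

  -- Each closed neighbourhood meets `⁅ x ⁆` in at most one vertex, so its count grows by at most
  -- one.
  add-vertex : ∀ {l B x} → IsLimitedPacking G l B → IsLimitedPacking G (suc l) (B ∪ ⁅ x ⁆)
  add-vertex {l} {B} {x} packing v = begin
    ∣ N[_] G v ∩ (B ∪ ⁅ x ⁆) ∣               ≡⟨ cong ∣_∣ (∩-distribˡ-∪ (N[_] G v) B ⁅ x ⁆) ⟩
    ∣ (N[_] G v ∩ B) ∪ (N[_] G v ∩ ⁅ x ⁆) ∣  ≤⟨ p⊆q⇒∣p∣≤∣q∣ shrink ⟩
    ∣ (N[_] G v ∩ B) ∪ ⁅ x ⁆ ∣               ≤⟨ ∣p∪⁅x⁆∣≤1+∣p∣ (N[_] G v ∩ B) x ⟩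
    suc ∣ N[_] G v ∩ B ∣                     ≤⟨ s≤s (packing v) ⟩
    suc l                                    ∎
    where
    open ≤-Reasoning
    shrink : (N[_] G v ∩ B) ∪ (N[_] G v ∩ ⁅ x ⁆) ⊆ (N[_] G v ∩ B) ∪ ⁅ x ⁆
    shrink = x∈p∪q⁺ ∘ map₂ (p∩q⊆q (N[_] G v) ⁅ x ⁆) ∘ x∈p∪q⁻ _ _

  add-vertices : ∀ j {l m} → j + m ≤ order → PackingOfSize G l m → PackingOfSize G (j + l) (j + m)
  add-vertices zero    _      packing = packing
  add-vertices (suc j) j+m<order packing
    with B , B-packing , ∣B∣≡j+m ← add-vertices j (<⇒≤ j+m<order) packing
    -- The bound `suc j + m ≤ order` leaves a vertex outside the `j + m` chosen so far.
    with x , x∉B ← ∣p∣<n⇒∃∉ B (≤-trans (s≤s (≤-reflexive ∣B∣≡j+m)) j+m<order) =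
    B ∪ ⁅ x ⁆ , add-vertex B-packing ,
    trans (≤-antisym (∣p∪⁅x⁆∣≤1+∣p∣ B x) (x∉p⇒∣p∣<∣p∪⁅x⁆∣ x∉B)) (cong suc ∣B∣≡j+m)

  -- Distances and the packing of distance levels

  module _ (conn : Connected G) where

    dist-walk : ∀ u v → Walk G u v (dist G conn u v)
    dist-walk u v = proj₁ (proj₂ (least (walk? G u v) (conn u v)))

    dist-minimal : ∀ {u v m} → Walk G u v m → dist G conn u v ≤ m
    dist-minimal {u} {v} {m} = proj₂ (proj₂ (least (walk? G u v) (conn u v))) m

    dist≤diam : ∀ u v → dist G conn u v ≤ diam G conn
    dist≤diam u v = ≤-trans (≤max-tabulate (dist G conn u) v)
      (≤max-tabulate (λ u → max 0 (tabulate (dist G conn u))) u)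

    nonadjacent⇒2≤diam : ∀ {u v} → ¬ u ≡ v → ¬ Adj u v → 2 ≤ diam G conn
    nonadjacent⇒2≤diam {u} {v} u≢v ¬uv =
      ≤-trans (2≤length (dist-walk u v)) (dist≤diam u v)
      where
      2≤length : ∀ {m} → Walk G u v m → 2 ≤ m
      2≤length []          = contradiction refl u≢v
      2≤length (uv ∷ [])   = contradiction uv ¬uv
      2≤length (_ ∷ _ ∷ _) = s≤s (s≤s z≤n)

    diam-attained : ∃[ s ] ∃[ t ] diam G conn ≤ dist G conn s t
    diam-attained
      with s , diam≤max ← max-tabulate-attained
             (λ u → max 0 (tabulate (dist G conn u))) (fromℕ< nontrivial)
      with t , max≤dist ← max-tabulate-attained (dist G conn s) s =
      s , t , ≤-trans diam≤max max≤dist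

    dist-Adj : ∀ {u v} t → Adj u v → dist G conn u t ≤ suc (dist G conn v t)
    dist-Adj t uv = dist-minimal (uv ∷ dist-walk _ t)

    dist-N[] : ∀ {v u} t → u ∈ N[_] G v →
               dist G conn u t ≤ suc (dist G conn v t) × dist G conn v t ≤ suc (dist G conn u t)
    dist-N[] t u∈ with ∈N[]⁻ u∈
    ... | inj₁ refl = n≤1+n _ , n≤1+n _
    ... | inj₂ vu   = dist-Adj t (adj-sym vu) , dist-Adj t vu

    -- A discrete intermediate value argument: the distance to `t` drops by at most one per step of
    -- the walk and ends at 0, so it cannot skip `i`.
    vertex-at-dist : ∀ {s t m i} → Walk G s t m → i ≤ dist G conn s t → ∃[ x ] dist G conn x t ≡ i
    vertex-at-dist {s} {t} {i = i} walk i≤dist with i ≟ dist G conn s t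
    ... | yes i≡dist = s , sym i≡dist
    vertex-at-dist {t = t} [] i≤dist | no i≢dist =
      contradiction (≤-trans (≤∧≢⇒< i≤dist i≢dist) (dist-minimal {u = t} [])) λ ()
    vertex-at-dist {t = t} (e ∷ walk) i≤dist | no i≢dist =
      vertex-at-dist walk (s≤s⁻¹ (≤-trans (≤∧≢⇒< i≤dist i≢dist) (dist-Adj t e)))

    module _ (t : Vertex) (f : ℕ → Vertex) {m : ℕ}
             (dist-f : ∀ i → i < m → dist G conn (f i) t ≡ i) where

      ∈-image⇒≡f[dist] : ∀ {x} → x ∈ image f m → x ≡ f (dist G conn x t)
      ∈-image⇒≡f[dist] x∈ with i , i<m , refl ← ∈-image⁻ f m x∈ = cong f (sym (dist-f i i<m))

      -- A member of the image is determined by its distance to `t`, and within `N[ v ]` this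
      -- distance is `a - 1`, `a` or `a + 1`. For `a = 0` the first two singletons below coincide,
      -- which only lowers the count.
      levels-3-limited : IsLimitedPacking G 3 (image f m)
      levels-3-limited v = begin
        ∣ N[_] G v ∩ image f m ∣                             ≤⟨ p⊆q⇒∣p∣≤∣q∣ near ⟩
        ∣ (⁅ f (pred a) ⁆ ∪ ⁅ f a ⁆) ∪ ⁅ f (suc a) ⁆ ∣       ≤⟨ ∣p∪⁅x⁆∣≤1+∣p∣ (⁅ f (pred a) ⁆ ∪ ⁅ f a ⁆) (f (suc a)) ⟩
        suc ∣ ⁅ f (pred a) ⁆ ∪ ⁅ f a ⁆ ∣                     ≤⟨ s≤s (∣p∪⁅x⁆∣≤1+∣p∣ ⁅ f (pred a) ⁆ (f a)) ⟩
        suc (suc ∣ ⁅ f (pred a) ⁆ ∣)                         ≡⟨ cong (2 +_) (∣⁅x⁆∣≡1 (f (pred a))) ⟩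
        3                                                    ∎
        where
        open ≤-Reasoning
        a = dist G conn v t

        level : ∀ x → x ≤ suc a → a ≤ suc x →
                f x ∈ (⁅ f (pred a) ⁆ ∪ ⁅ f a ⁆) ∪ ⁅ f (suc a) ⁆
        level x x≤1+a a≤1+x with m≤n⇒m<n∨m≡n x≤1+a
        ... | inj₂ refl = x∈p∪q⁺ (inj₂ (x∈⁅x⁆ _))
        ... | inj₁ (s≤s x≤a) with m≤n⇒m<n∨m≡n x≤a
        ...   | inj₂ refl = x∈p∪q⁺ (inj₁ (x∈p∪q⁺ (inj₂ (x∈⁅x⁆ _))))
        -- Here `a = suc x`, so `pred a` reduces to `x` after the rewrite.
        ...   | inj₁ x<a rewrite ≤-antisym a≤1+x x<a =
          x∈p∪q⁺ (inj₁ (x∈p∪q⁺ (inj₁ (x∈⁅x⁆ _))))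

        near : N[_] G v ∩ image f m ⊆ (⁅ f (pred a) ⁆ ∪ ⁅ f a ⁆) ∪ ⁅ f (suc a) ⁆
        near {x} x∈ with x∈N , x∈P ← x∈p∩q⁻ _ _ x∈ =
          subst (_∈ _) (sym (∈-image⇒≡f[dist] x∈P))
            (level (dist G conn x t) (proj₁ (dist-N[] t x∈N)) (proj₂ (dist-N[] t x∈N)))

    -- The distance to `t` recovers the index, so `f` is injective below `m` and each adjoined
    -- vertex is new.
    ∣image∣≡ : ∀ t f m → (∀ i → i < m → dist G conn (f i) t ≡ i) → ∣ image f m ∣ ≡ m
    ∣image∣≡ t f zero    _      = ∣⊥∣≡0 order
    ∣image∣≡ t f (suc m) dist-f = trans
      (≤-antisym (∣p∪⁅x⁆∣≤1+∣p∣ (image f m) (f m)) (x∉p⇒∣p∣<∣p∪⁅x⁆∣ fm∉))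
      (cong suc (∣image∣≡ t f m λ i i<m → dist-f i (m<n⇒m<1+n i<m)))
      where
      fm∉ : f m ∉ image f m
      fm∉ fm∈ with i , i<m , fm≡fi ← ∈-image⁻ f m fm∈ = <⇒≢ i<m
        (trans (sym (dist-f i (m<n⇒m<1+n i<m)))
        (trans (cong (λ x → dist G conn x t) (sym fm≡fi)) (dist-f m ≤-refl)))

    dist-packing : ∀ s t → PackingOfSize G 3 (suc (dist G conn s t))
    dist-packing s t = image f (suc d) , levels-3-limited t f dist-f , ∣image∣≡ t f (suc d) dist-f
      where
      d = dist G conn s t

      -- Truncating at `d` makes the choice total on ℕ; only indices up to `d` enter the image.
      at-min : ∀ i → ∃[ x ] dist G conn x t ≡ i ⊓ d
      at-min i = vertex-at-dist (dist-walk s t) (m⊓n≤n i d)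

      f : ℕ → Vertex
      f = proj₁ ∘ at-min

      dist-f : ∀ i → i < suc d → dist G conn (f i) t ≡ i
      dist-f i (s≤s i≤d) = trans (proj₂ (at-min i)) (m≤n⇒m⊓n≡m i≤d)

  -- Inclusion-exclusion for `N[ v ]` and the packing: the union fits into the vertex set, and the
  -- intersection has at most `l` elements.
  degree+packing≤order : ∀ {l m} v → PackingOfSize G l m → suc (degree G v) + m ≤ order + l
  degree+packing≤order {l} v (B , packing , refl) = begin
    suc (degree G v) + ∣ B ∣                ≤⟨ +-monoˡ-≤ ∣ B ∣ (degree<∣N[]∣ v) ⟩
    ∣ N[_] G v ∣ + ∣ B ∣                    ≡⟨ ∣p∪q∣+∣p∩q∣≡∣p∣+∣q∣ (N[_] G v) B ⟨
    ∣ N[_] G v ∪ B ∣ + ∣ N[_] G v ∩ B ∣     ≤⟨ +-mono-≤ (∣p∣≤n (N[_] G v ∪ B)) (packing v) ⟩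
    order + l                               ∎
    where open ≤-Reasoning

  packing≤L : ∀ {k m} → PackingOfSize G k m → m ≤ L k G
  packing≤L {k} {m} = proj₂ (proj₂ (greatestPacking G k)) m

  -- When `N[ v ]` is the whole vertex set, the packing condition at `v` bounds the entire packing.
  dominating⇒L≤ : ∀ {k v} → (∀ x → x ∈ N[_] G v) → L k G ≤ k
  dominating⇒L≤ {k} {v} dominating
    with B , packing , ∣B∣≡L ← proj₁ (proj₂ (greatestPacking G k)) = begin
      L k G                   ≡⟨ ∣B∣≡L ⟨
      ∣ B ∣                   ≤⟨ p⊆q⇒∣p∣≤∣q∣ (λ x∈B → x∈p∩q⁺ (dominating _ , x∈B)) ⟩
      ∣ N[_] G v ∩ B ∣        ≤⟨ packing v ⟩
      k                       ∎
    where open ≤-Reasoning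

-- The lower bound

diam+k∸2≤L : ∀ k → k ≥ 3 → (G : Graph) (conn : Connected G) → Δ G ≥ k →
             L k G ≥ (diam G conn + k) ∸ 2
-- Writing `k = 3 + j` makes `j` the number of vertices to add to the 3-limited packing.
diam+k∸2≤L k@(suc (suc (suc j))) (s≤s (s≤s (s≤s _))) G conn k≤Δ
  with s , t , diam≤d ← diam-attained G conn
  with v , Δ≤degree ← max-tabulate-attained (degree G) s = begin
    (diam G conn + k) ∸ 2  ≤⟨ ∸-monoˡ-≤ 2 (+-monoˡ-≤ k diam≤d) ⟩
    (d + k) ∸ 2            ≡⟨ cong (_∸ 2) (+-comm d k) ⟩
    suc (j + d)            ≡⟨ +-suc j d ⟨
    j + suc d              ≤⟨ packing≤L G (subst (λ l → PackingOfSize G l (j + suc d)) (+-comm j 3)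
                                (add-vertices G j room (dist-packing G conn s t))) ⟩
    L k G                  ∎
  where
  open ≤-Reasoning
  d = dist G conn s t

  -- Of the at least `k + 1` vertices in the closed neighbourhood of `v`, at most 3 lie in the
  -- packing, so more than `j` vertices are free.
  room : j + suc d ≤ Graph.order G
  room = +-cancelʳ-≤ 3 _ _ (begin
    j + suc d + 3                ≡⟨ +-comm (j + suc d) 3 ⟩
    k + suc d                    ≤⟨ n≤1+n _ ⟩
    suc k + suc d                ≤⟨ +-monoˡ-≤ (suc d) (s≤s (≤-trans k≤Δ Δ≤degree)) ⟩
    suc (degree G v) + suc d     ≤⟨ degree+packing≤order G v (dist-packing G conn s t) ⟩
    Graph.order G + 3            ∎)

-- From `diam ≥ 2` follows `k ≤ diam + k - 2`, so the upper bound `k` on `L` meets the general lower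
-- bound.
L≡diam+k∸2 : ∀ k → k ≥ 3 → (G : Graph) (conn : Connected G) → Δ G ≥ k →
             diam G conn ≥ 2 → L k G ≤ k → L k G ≡ (diam G conn + k) ∸ 2
L≡diam+k∸2 k k≥3 G conn k≤Δ 2≤diam L≤k = ≤-antisym
  (≤-trans L≤k (∸-monoˡ-≤ 2 (+-monoˡ-≤ k 2≤diam)))
  (diam+k∸2≤L k k≥3 G conn k≤Δ)

-- Stars and tightness

data StarAdj {n : ℕ} : Rel (Fin (suc n)) 0ℓ where
  to-leaf   : ∀ {i} → StarAdj zero (suc i)
  to-centre : ∀ {i} → StarAdj (suc i) zero

starAdj? : B.Decidable (StarAdj {n})
starAdj? zero    zero    = no λ ()
starAdj? zero    (suc _) = yes to-leaf
starAdj? (suc _) zero    = yes to-centre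
starAdj? (suc _) (suc _) = no λ ()

-- The star with n + 1 leaves: nontriviality excludes the one without leaves.
star : ℕ → Graph
star n = record
  { order      = suc (suc n)
  ; nontrivial = s≤s (s≤s z≤n)
  ; Adj        = StarAdj
  ; adj?       = starAdj?
  ; adj-sym    = λ where
      to-leaf   → to-centre
      to-centre → to-leaf
  ; adj-irrefl = λ where refl ()
  }

star-connected : ∀ n → Connected (star n)
star-connected n zero    zero    = 0 , []
star-connected n zero    (suc _) = 1 , to-leaf ∷ []
star-connected n (suc _) zero    = 1 , to-centre ∷ []
star-connected n (suc _) (suc _) = 2 , to-centre ∷ (to-leaf ∷ [])

∈N[centre] : ∀ n x → x ∈ N[_] (star n) zero
∈N[centre] n zero    = ∈N[]⁺ (star n) (inj₁ refl)
∈N[centre] n (suc _) = ∈N[]⁺ (star n) (inj₂ to-leaf)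

star-Δ : ∀ n → Δ (star n) ≥ suc n
star-Δ n = begin
  suc n                           ≡⟨ ∣⊤∣≡n (suc n) ⟨
  ∣ outside ∷ ⊤ {n = suc n} ∣     ≤⟨ p⊆q⇒∣p∣≤∣q∣ leaves⊆N ⟩
  degree (star n) zero            ≤⟨ ≤max-tabulate (degree (star n)) zero ⟩
  Δ (star n)                      ∎
  where
  open ≤-Reasoning
  leaves⊆N : outside ∷ ⊤ ⊆ N (star n) zero
  leaves⊆N {suc _} _ = ∈N⁺ (star n) to-leaf

star-L : ∀ n → L (suc n) (star n) ≤ suc n
star-L n = dominating⇒L≤ (star n) {suc n} {zero} (∈N[centre] n)

-- The index `suc n` guarantees two leaves, which are distinct and nonadjacent.
star-diam : ∀ n → diam (star (suc n)) (star-connected (suc n)) ≥ 2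
star-diam n = nonadjacent⇒2≤diam (star (suc n)) (star-connected (suc n))
  {suc zero} {suc (suc zero)} (λ ()) (λ ())

theorem3p6 : (∀ (k : ℕ) → k ≥ 3 → (G : Graph) (conn : Connected G) → Δ G ≥ k →
    L k G ≥ (diam G conn + k) ∸ 2)
    × (∀ (k : ℕ) → k ≥ 3 →
    Σ[ G ∈ Graph ] Σ[ conn ∈ Connected G ]
    (Δ G ≥ k × L k G ≡ (diam G conn + k) ∸ 2))
theorem3p6 = diam+k∸2≤L , tight
  where
  tight : ∀ k → k ≥ 3 → Σ[ G ∈ Graph ] Σ[ conn ∈ Connected G ]
          (Δ G ≥ k × L k G ≡ (diam G conn + k) ∸ 2)
  -- With `k = n + 2`, the graph `star (suc n)` has exactly `k` leaves, since `star` has one leaf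
  -- more than its index.
  tight (suc (suc n)) k≥3@(s≤s (s≤s _)) = star (suc n) , star-connected (suc n) , star-Δ (suc n) ,
    L≡diam+k∸2 (suc (suc n)) k≥3 (star (suc n)) (star-connected (suc n))
      (star-Δ (suc n)) (star-diam n) (star-L (suc n))
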